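{- Let $m>1$ be an odd integer divisible by $3$. Then the elliptic curve over $\mathbf{Q}$ given by \[ E_m \colon y^2 = x^3 - x + m^6 \] has rank at least $3$.
   Context: The rank of an elliptic curve $E/\mathbf{Q}$ is the integer $r\ge 0$ such that $E(\mathbf{Q}) \simeq \mathbf{Z}^r \oplus T$ with $T$ a finite abelian group (Mordell-Weil theorem). -}

module Defs where

open import Algebra.Bundles using (AbelianGroup)
open import Algebra.Bundles.Raw using (RawGroup)
import Algebra.Construct.DirectProduct as DirectProduct
import Algebra.Construct.Pointwise as Pointwise
open import Algebra.Morphism.Structures using (module GroupMorphisms)
open import Data.Fin.Base using (Fin)
open import Data.Integer.Base as ℤ using (ℤ; +_)
import Data.Integer.Properties as ℤ
import Data.Integer.Divisibility.Signed as ℤ∣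
open import Data.Integer.Solver using () renaming (module +-*-Solver to ℤSolver)
open import Data.Nat.Base using (ℕ)
import Data.Nat.Divisibility as ℕ
open import Data.Product.Base using (_×_; Σ; ∃)
open import Data.Rational.Base
open import Data.Rational.Literals using (fromℤ)
open import Data.Rational.Properties
open import Data.Rational.Solver using () renaming (module +-*-Solver to ℚSolver)
import Data.Rational.Unnormalised.Base as ℚᵘ
import Data.Rational.Unnormalised.Properties as ℚᵘ
open import Function.Base using (_∘_)
open import Function.Bundles using (Inverse)
open import Level using (0ℓ)
open import Relation.Binary.PropositionalEquality
open import Relation.Nullary using (yes; no)
open import Relation.Nullary.Decidable using (from-no)

cancel-nonZero : ∀ d .{{_ : NonZero d}} z → d * z ≡ 0ℚ → z ≡ 0ℚ
cancel-nonZero d z dz≡0 = begin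
  z               ≡⟨ *-identityˡ z ⟨
  1ℚ * z          ≡⟨ cong (_* z) (*-inverseˡ d) ⟨
  1/ d * d * z    ≡⟨ *-assoc (1/ d) d z ⟩
  1/ d * (d * z)  ≡⟨ cong (1/ d *_) dz≡0 ⟩
  1/ d * 0ℚ       ≡⟨ *-zeroʳ (1/ d) ⟩
  0ℚ              ∎
  where
  open ≡-Reasoning

÷-*-cancel : ∀ n d .{{_ : NonZero d}} → (n ÷ d) * d ≡ n
÷-*-cancel n d =
  trans (*-assoc n (1/ d) d) (trans (cong (n *_) (*-inverseˡ d)) (*-identityʳ n))

x-y≡0⇒x≡y : ∀ x y → x - y ≡ 0ℚ → x ≡ y
x-y≡0⇒x≡y x y eq = begin
  x            ≡⟨ solve 2 (λ x y → x := (x :- y) :+ y) refl x y ⟩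
  (x - y) + y  ≡⟨ cong (_+ y) eq ⟩
  0ℚ + y       ≡⟨ +-identityˡ y ⟩
  y            ∎
  where
  open ≡-Reasoning
  open ℚSolver

x≡y⇒x-y≡0 : ∀ {x y} → x ≡ y → x - y ≡ 0ℚ
x≡y⇒x-y≡0 {x} refl = +-inverseʳ x

x*x≡0⇒x≡0 : ∀ x → x * x ≡ 0ℚ → x ≡ 0ℚ
x*x≡0⇒x≡0 x xx≡0 with x ≟ 0ℚ
... | yes x≡0 = x≡0
... | no  x≢0 = cancel-nonZero x {{≢-nonZero x≢0}} x xx≡0

-- Elliptic curves y² = x³ + ax + b over ℚ.  Since ℚ has characteristic
-- different from 2 and 3, every elliptic curve over ℚ has this form.
record EllipticCurve : Set where
  field
    a b         : ℚ
    nonsingular : fromℤ (+ 4) * (a * a * a) + fromℤ (+ 27) * (b * b) ≢ 0ℚ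

module _ (E : EllipticCurve) where

  open EllipticCurve E

  OnCurve : ℚ → ℚ → Set
  OnCurve x y = y * y ≡ x * x * x + a * x + b

  -- The curve equation is an irrelevant field, so _≡_ on points is equality
  -- of coordinates.
  data Point : Set where
    ∞   : Point
    aff : (x y : ℚ) → .(OnCurve x y) → Point

  -- The line of slope l through (x₁ , y₁) meets the cubic at x₁ and, counted
  -- with multiplicity, at x₂ exactly when `secant` holds; the conclusion
  -- concerns the reflection of the third intersection point.
  third : ∀ x₁ y₁ x₂ l → OnCurve x₁ y₁ →
          (y₁ + y₁) * l + l * l * (x₂ - x₁) ≡ x₁ * x₁ + x₁ * x₂ + x₂ * x₂ + a →
          OnCurve (l * l - x₁ - x₂) (l * (x₁ - (l * l - x₁ - x₂)) - y₁)
  third x₁ y₁ x₂ l on₁ secant = begin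
    _  ≡⟨ solve 6 (λ x₁ y₁ x₂ l a b →
            let x₃ = l :* l :- x₁ :- x₂
                y₃ = l :* (x₁ :- x₃) :- y₁ in
            y₃ :* y₃ :=
              (x₃ :* x₃ :* x₃ :+ a :* x₃ :+ b)
              :+ ((y₁ :* y₁ :- (x₁ :* x₁ :* x₁ :+ a :* x₁ :+ b))
              :+ (x₃ :- x₁) :* (((y₁ :+ y₁) :* l :+ l :* l :* (x₂ :- x₁))
                 :- (x₁ :* x₁ :+ x₁ :* x₂ :+ x₂ :* x₂ :+ a))))
            refl x₁ y₁ x₂ l a b ⟩
    f + ((y₁ * y₁ - _) + t * _)
       ≡⟨ cong₂ (λ u v → f + (u + t * v)) (x≡y⇒x-y≡0 on₁) (x≡y⇒x-y≡0 secant) ⟩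
    f + (0ℚ + t * 0ℚ)
       ≡⟨ solve 2 (λ f t → f :+ (con 0ℚ :+ t :* con 0ℚ) := f) refl f t ⟩
    f  ∎
    where
    open ≡-Reasoning
    open ℚSolver
    x₃ = l * l - x₁ - x₂
    f  = x₃ * x₃ * x₃ + a * x₃ + b
    t  = x₃ - x₁

  chord-nonZero : ∀ x₁ x₂ → x₁ ≢ x₂ → NonZero (x₂ - x₁)
  chord-nonZero x₁ x₂ x₁≢x₂ = ≢-nonZero (x₁≢x₂ ∘ sym ∘ x-y≡0⇒x≡y x₂ x₁)

  tangent-nonZero : ∀ x₁ y₁ x₂ y₂ → OnCurve x₁ y₁ → OnCurve x₂ y₂ → x₁ ≡ x₂ →
                    y₁ ≢ - y₂ → NonZero (fromℤ (+ 2) * y₁)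
  tangent-nonZero x₁ y₁ x₂ y₂ on₁ on₂ refl y₁≢-y₂ = ≢-nonZero λ 2y₁≡0 →
    let y₁≡0 = cancel-nonZero (fromℤ (+ 2)) y₁ 2y₁≡0
        y₂≡0 = x*x≡0⇒x≡0 y₂ (trans on₂ (trans (sym on₁) (cong (λ y → y * y) y₁≡0)))
    in y₁≢-y₂ (trans y₁≡0 (cong -_ (sym y₂≡0)))

  chord-on : ∀ x₁ y₁ x₂ y₂ → OnCurve x₁ y₁ → OnCurve x₂ y₂ →
             .{{_ : NonZero (x₂ - x₁)}} →
             let l  = (y₂ - y₁) ÷ (x₂ - x₁)
                 x₃ = l * l - x₁ - x₂ in
             OnCurve x₃ (l * (x₁ - x₃) - y₁)
  chord-on x₁ y₁ x₂ y₂ on₁ on₂ =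
    third x₁ y₁ x₂ l on₁ (x-y≡0⇒x≡y _ _ (cancel-nonZero d _ (begin
      _  ≡⟨ solve 6 (λ x₁ y₁ x₂ l a b →
              d′ x₁ x₂ :* (((y₁ :+ y₁) :* l :+ l :* l :* (x₂ :- x₁))
               :- (x₁ :* x₁ :+ x₁ :* x₂ :+ x₂ :* x₂ :+ a)) :=
              (y₁ :+ l :* d′ x₁ x₂) :* (y₁ :+ l :* d′ x₁ x₂)
                :- (x₂ :* x₂ :* x₂ :+ a :* x₂ :+ b)
                :- (y₁ :* y₁ :- (x₁ :* x₁ :* x₁ :+ a :* x₁ :+ b)))
              refl x₁ y₁ x₂ l a b ⟩
      (y₁ + l * d) * (y₁ + l * d) - f₂ - (y₁ * y₁ - f₁)
         ≡⟨ cong (λ y → y * y - f₂ - (y₁ * y₁ - f₁)) y₁+ld≡y₂ ⟩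
      y₂ * y₂ - f₂ - (y₁ * y₁ - f₁)
         ≡⟨ cong₂ _-_ (x≡y⇒x-y≡0 on₂) (x≡y⇒x-y≡0 on₁) ⟩
      0ℚ - 0ℚ
         ≡⟨⟩
      0ℚ ∎)))
    where
    open ≡-Reasoning
    open ℚSolver
    d  = x₂ - x₁
    d′ : ∀ {n} → Polynomial n → Polynomial n → Polynomial n
    d′ x₁ x₂ = x₂ :- x₁
    l  = (y₂ - y₁) ÷ d
    f₁ = x₁ * x₁ * x₁ + a * x₁ + b
    f₂ = x₂ * x₂ * x₂ + a * x₂ + b
    y₁+ld≡y₂ : y₁ + l * d ≡ y₂
    y₁+ld≡y₂ = trans (cong (_+_ y₁) (÷-*-cancel (y₂ - y₁) d))
                     (solve 2 (λ y₁ y₂ → y₁ :+ (y₂ :- y₁) := y₂) refl y₁ y₂)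

  tangent-on : ∀ x₁ y₁ → OnCurve x₁ y₁ → .{{_ : NonZero (fromℤ (+ 2) * y₁)}} →
               let l  = (fromℤ (+ 3) * (x₁ * x₁) + a) ÷ (fromℤ (+ 2) * y₁)
                   x₃ = l * l - x₁ - x₁ in
               OnCurve x₃ (l * (x₁ - x₃) - y₁)
  tangent-on x₁ y₁ on₁ = third x₁ y₁ x₁ l on₁ (begin
    (y₁ + y₁) * l + l * l * (x₁ - x₁)
       ≡⟨ solve 3 (λ x₁ y₁ l → (y₁ :+ y₁) :* l :+ l :* l :* (x₁ :- x₁)
                               := l :* (con (fromℤ (+ 2)) :* y₁)) refl x₁ y₁ l ⟩
    l * (fromℤ (+ 2) * y₁)
       ≡⟨ ÷-*-cancel _ (fromℤ (+ 2) * y₁) ⟩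
    fromℤ (+ 3) * (x₁ * x₁) + a
       ≡⟨ solve 2 (λ x₁ a → con (fromℤ (+ 3)) :* (x₁ :* x₁) :+ a
                            := x₁ :* x₁ :+ x₁ :* x₁ :+ x₁ :* x₁ :+ a) refl x₁ a ⟩
    x₁ * x₁ + x₁ * x₁ + x₁ * x₁ + a ∎)
    where
    open ≡-Reasoning
    open ℚSolver
    l = (fromℤ (+ 3) * (x₁ * x₁) + a) ÷ (fromℤ (+ 2) * y₁)

  chord : ∀ x₁ y₁ x₂ y₂ → .(OnCurve x₁ y₁) → .(OnCurve x₂ y₂) →
          .{{_ : NonZero (x₂ - x₁)}} → Point
  chord x₁ y₁ x₂ y₂ on₁ on₂ = aff x₃ (l * (x₁ - x₃) - y₁) (chord-on x₁ y₁ x₂ y₂ on₁ on₂)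
    where
    l  = (y₂ - y₁) ÷ (x₂ - x₁)
    x₃ = l * l - x₁ - x₂

  tangent : ∀ x₁ y₁ → .(OnCurve x₁ y₁) → .{{_ : NonZero (fromℤ (+ 2) * y₁)}} → Point
  tangent x₁ y₁ on₁ = aff x₃ (l * (x₁ - x₃) - y₁) (tangent-on x₁ y₁ on₁)
    where
    l  = (fromℤ (+ 3) * (x₁ * x₁) + a) ÷ (fromℤ (+ 2) * y₁)
    x₃ = l * l - x₁ - x₁

  infixl 6 _⊕_
  infix  8 ⊖_

  -- When x₁ = x₂ and y₁ ≠ - y₂ the curve equation forces y₁ = y₂, so the last
  -- case is doubling.
  _⊕_ : Point → Point → Point
  ∞               ⊕ Q   = Q
  P@(aff _ _ _)   ⊕ ∞   = P
  (aff x₁ y₁ on₁) ⊕ (aff x₂ y₂ on₂) with x₁ ≟ x₂ | y₁ ≟ - y₂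
  ... | no  x₁≢x₂ | _         = chord x₁ y₁ x₂ y₂ on₁ on₂ {{chord-nonZero x₁ x₂ x₁≢x₂}}
  ... | yes _     | yes _     = ∞
  ... | yes x₁≡x₂ | no y₁≢-y₂ =
    tangent x₁ y₁ on₁ {{tangent-nonZero x₁ y₁ x₂ y₂ on₁ on₂ x₁≡x₂ y₁≢-y₂}}

  ⊖_ : Point → Point
  ⊖ ∞          = ∞
  ⊖ aff x y on = aff x (- y) (trans (solve 1 (λ y → :- y :* :- y := y :* y) refl y) on)
    where
    open ℚSolver

  -- The Mordell–Weil group E(ℚ).  Only the operations are packaged: the group
  -- laws are not needed to say that E(ℚ) is isomorphic to a given group.
  rationalPoints : RawGroup 0ℓ 0ℓ
  rationalPoints = record
    { Carrier = Point ; _≈_ = _≡_ ; _∙_ = _⊕_ ; ε = ∞ ; _⁻¹ = ⊖_ }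

infix 4 _≅_

_≅_ : RawGroup 0ℓ 0ℓ → RawGroup 0ℓ 0ℓ → Set
G ≅ H = Σ (RawGroup.Carrier G → RawGroup.Carrier H)
            (GroupMorphisms.IsGroupIsomorphism G H)

Finite : AbelianGroup 0ℓ 0ℓ → Set
Finite T = ∃ λ n → Inverse (AbelianGroup.setoid T) (setoid (Fin n))

ℤ^ : ℕ → AbelianGroup 0ℓ 0ℓ
ℤ^ r = Pointwise.abelianGroup (Fin r) ℤ.+-0-abelianGroup

infixr 6 _⊞_

_⊞_ : AbelianGroup 0ℓ 0ℓ → AbelianGroup 0ℓ 0ℓ → AbelianGroup 0ℓ 0ℓ
_⊞_ = DirectProduct.abelianGroup

-- By the Mordell–Weil theorem there is exactly one such r; a statement about
-- the rank of E is a statement about every r with `HasRank E r`.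
HasRank : EllipticCurve → ℕ → Set₁
HasRank E r = Σ (AbelianGroup 0ℓ 0ℓ) λ T →
  Finite T × rationalPoints E ≅ AbelianGroup.rawGroup (ℤ^ r ⊞ T)

fromℤ-* : ∀ i j → fromℤ (i ℤ.* j) ≡ fromℤ i * fromℤ j
fromℤ-* i j = toℚᵘ-injective (ℚᵘ.≃-sym (toℚᵘ-homo-* (fromℤ i) (fromℤ j)))

fromℤ-+ : ∀ i j → fromℤ (i ℤ.+ j) ≡ fromℤ i + fromℤ j
fromℤ-+ i j = toℚᵘ-injective (ℚᵘ.≃-sym (ℚᵘ.≃-trans (toℚᵘ-homo-+ (fromℤ i) (fromℤ j))
  (ℚᵘ.*≡* (cong (ℤ._* + 1) (cong₂ ℤ._+_ (ℤ.*-identityʳ i) (ℤ.*-identityʳ j))))))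

27n²≢4 : ∀ n → ℤ.- (+ 4) ℤ.+ + 27 ℤ.* (n ℤ.* n) ≢ + 0
27n²≢4 n eq = from-no (3 ℕ.∣? 4) (ℤ∣.∣⇒∣ᵤ (ℤ∣.divides (+ 9 ℤ.* (n ℤ.* n)) (begin
  + 4
    ≡⟨ solve 1 (λ n → con (+ 4) := con (+ 9) :* (n :* n) :* con (+ 3)
                       :- (con (ℤ.- (+ 4)) :+ con (+ 27) :* (n :* n))) refl n ⟩
  + 9 ℤ.* (n ℤ.* n) ℤ.* + 3 ℤ.- (ℤ.- (+ 4) ℤ.+ + 27 ℤ.* (n ℤ.* n))
    ≡⟨ cong (λ z → + 9 ℤ.* (n ℤ.* n) ℤ.* + 3 ℤ.- z) eq ⟩
  + 9 ℤ.* (n ℤ.* n) ℤ.* + 3 ℤ.- + 0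
    ≡⟨ ℤ.+-identityʳ _ ⟩
  + 9 ℤ.* (n ℤ.* n) ℤ.* + 3 ∎)))
  where
  open ≡-Reasoning
  open ℤSolver

nonsingular-E : ∀ n → fromℤ (+ 4) * (- 1ℚ * - 1ℚ * - 1ℚ)
                      + fromℤ (+ 27) * (fromℤ n * fromℤ n) ≢ 0ℚ
nonsingular-E n eq = 27n²≢4 n (cong ↥_ (begin
  fromℤ (ℤ.- (+ 4) ℤ.+ + 27 ℤ.* (n ℤ.* n))
    ≡⟨ fromℤ-+ (ℤ.- (+ 4)) (+ 27 ℤ.* (n ℤ.* n)) ⟩
  fromℤ (ℤ.- (+ 4)) + fromℤ (+ 27 ℤ.* (n ℤ.* n))
    ≡⟨ cong (λ z → fromℤ (ℤ.- (+ 4)) + z)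
         (trans (fromℤ-* (+ 27) (n ℤ.* n)) (cong (fromℤ (+ 27) *_) (fromℤ-* n n))) ⟩
  fromℤ (ℤ.- (+ 4)) + fromℤ (+ 27) * (fromℤ n * fromℤ n)
    ≡⟨ eq ⟩
  0ℚ ∎))
  where
  open ≡-Reasoning

E : ℤ → EllipticCurve
E m = record { a = - 1ℚ ; b = fromℤ (m ℤ.^ 6) ; nonsingular = nonsingular-E (m ℤ.^ 6) }

{-# OPTIONS --safe #-}

-- A curve E : y² = x³ - x + b with b odd has no rational 2-torsion, because the cubic has no root
-- modulo 2; so E(ℚ)/2E(ℚ) ≅ (ℤ/2)^r, and it suffices that the seven nonempty subset sums of
-- three points are not doubles.  With b = m⁶ the points P = (-m², m), Q = (0, m³) and R = (1, m³)
-- have this property.  By the duplication formula the abscissa of 2(x, y) is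
-- ((x² + 1)² - 8bx) / 4(x³ - x + b).  As 3 ∣ x³ - x for integral x, and 3 ∣ b, the denominator
-- of this abscissa is divisible by 3; this excludes every sum but P + Q, since E reduces to a
-- curve with E(𝔽₃) = {O, (0,0), (±1,0)} on which Q and R are independent and P + Q = O.
-- The sum P + Q is excluded 2-adically: its abscissa is 1 modulo 4, while the abscissa of a
-- double that is a 2-adic integer is 3 modulo 4.
module Submission where

open import Defs
open import Algebra.Bundles using (AbelianGroup; RawGroup)
open import Algebra.Morphism.Structures using (module GroupMorphisms)
import Algebra.Properties.AbelianGroup as AbelianGroupProperties
import Algebra.Properties.CommutativeSemigroup as CommutativeSemigroupProperties
open import Data.Empty using (⊥; ⊥-elim)
open import Data.Fin.Base using (Fin; zero; suc; punchOut)
open import Data.Fin.Properties as Fin using (all?; any?; punchOut-injective; injective⇒≤)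
open import Data.Integer.Base as ℤ using (ℤ; +_; _<_)
open import Data.Integer.DivMod using (_%ℕ_; _/ℕ_; a≡a%ℕn+[a/ℕn]*n; n%ℕd<d)
open import Data.Integer.Divisibility using (_∣_)
open import Data.Integer.Divisibility.Signed as ℤ∣
  using (divides; quotient; ∣ᵤ⇒∣; ∣⇒∣ᵤ; ∣-refl; ∣-trans; ∣m⇒∣-m; ∣m∣n⇒∣m+n; ∣m∣n⇒∣m-n;
         ∣m+n∣m⇒∣n; ∣m+n∣n⇒∣m; ∣m⇒∣m*n; ∣n⇒∣m*n)
  renaming (_∣_ to _∣ₛ_; _∣?_ to _∣ₛ?_)
import Data.Integer.Properties as ℤ
open import Data.Integer.Solver using () renaming (module +-*-Solver to ℤSolver)
open import Data.Nat.Base as ℕ using (_≤_; suc; s≤s)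
import Data.Nat.Divisibility as ℕ
import Data.Nat.Properties as ℕ
open import Data.Product.Base using (_×_; ∃; ∃₂; _,_; proj₁; proj₂)
open import Data.Rational.Base as ℚ using (ℚ; mkℚ; 0ℚ; 1ℚ; ↥_; ↧_)
open import Data.Rational.Literals using (fromℤ)
import Data.Rational.Properties as ℚ
open import Data.Rational.Solver using () renaming (module +-*-Solver to ℚSolver)
import Data.Rational.Unnormalised.Base as ℚᵘ
import Data.Rational.Unnormalised.Properties as ℚᵘ
open import Data.Sum.Base as Sum using (_⊎_; inj₁; inj₂)
open import Function.Base using (_∘_; id)
open import Function.Bundles using (Inverse; Injection)
open import Function.Definitions using (Injective)
open import Function.Properties.Inverse using (Inverse⇒Injection)
open import Level using (0ℓ)
open import Relation.Binary.PropositionalEquality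
open import Relation.Nullary using (¬_; Dec; yes; no; recompute)
open import Relation.Nullary.Decidable using (from-yes; from-no; _⊎-dec_; _×-dec_)
open import Relation.Unary using (Decidable)

-- Rank from independence modulo doubling

-- Pigeonhole: if `j` were missed, punching out `j` would turn `f` into an injection of `suc n`
-- elements into `n`.
injective⇒surjective : ∀ {n} (f : Fin n → Fin n) → Injective _≡_ _≡_ f →
                       ∀ j → ∃ λ i → f i ≡ j
injective⇒surjective {suc n} f f-injective j with any? (λ i → f i Fin.≟ j)
... | yes hit  = hit
... | no  miss = ⊥-elim (ℕ.1+n≰n (injective⇒≤ {f = λ i → punchOut (j≢f i)}
                   (λ {i} {i′} → f-injective ∘ punchOut-injective (j≢f i) (j≢f i′))))
  where
  j≢f : ∀ i → j ≢ f i
  j≢f i j≡fi = miss (i , sym j≡fi)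

-- This and `Double` take raw groups so as to apply both to `rationalPoints` and to `T`.
NoTwoTorsion : RawGroup 0ℓ 0ℓ → Set
NoTwoTorsion G = ∀ g → g ∙ g ≈ ε → g ≈ ε
  where open RawGroup G

Double : (G : RawGroup 0ℓ 0ℓ) → RawGroup.Carrier G → Set
Double G h = ∃ λ g → g ∙ g ≈ h
  where open RawGroup G

-- In the absence of 2-torsion the doubling endomorphism is injective, and an injective self-map of
-- a finite set is onto.
finite⇒double : (T : AbelianGroup 0ℓ 0ℓ) → Finite T →
                NoTwoTorsion (AbelianGroup.rawGroup T) →
                ∀ t → Double (AbelianGroup.rawGroup T) t
finite⇒double T (n , T↔Fin) noTwoTorsion t =
  let i , fi≡t = injective⇒surjective f f-injective (to t)
  in from i , to-injective fi≡t
  where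
  open AbelianGroup T renaming (trans to ≈-trans; sym to ≈-sym)
  open AbelianGroupProperties T using (⁻¹-∙-comm; x∙y⁻¹≈ε⇒x≈y)
  open CommutativeSemigroupProperties commutativeSemigroup using (interchange)
  open Inverse T↔Fin using (to; from; to-cong; strictlyInverseˡ)
  open Injection (Inverse⇒Injection T↔Fin) using () renaming (injective to to-injective)

  double-injective : ∀ {s u} → s ∙ s ≈ u ∙ u → s ≈ u
  double-injective {s} {u} ss≈uu = x∙y⁻¹≈ε⇒x≈y s u (noTwoTorsion _
    (≈-trans (interchange s (u ⁻¹) s (u ⁻¹))
    (≈-trans (∙-cong ss≈uu (⁻¹-∙-comm u u)) (inverseʳ (u ∙ u)))))

  f : Fin n → Fin n
  f i = to (from i ∙ from i)

  f-injective : Injective _≡_ _≡_ f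
  f-injective {i} {j} fi≡fj = trans (sym (strictlyInverseˡ i))
    (trans (to-cong (double-injective (to-injective fi≡fj)))
           (strictlyInverseˡ j))

-- With `P` read as vanishing, this is linear dependence of three vectors over the field with two
-- elements: coefficients are 0 or 1, so a nontrivial relation is a nonempty subset sum.
SomeSum : {A : Set} → (A → A → A) → (A → Set) → A → A → A → Set
SomeSum _∙_ P a b c =
  P a ⊎ P b ⊎ P c ⊎ P (a ∙ b) ⊎ P (a ∙ c) ⊎ P (b ∙ c) ⊎ P (a ∙ (b ∙ c))

-- A sum of images is the image of the sum bracketed in the same way, so a relation among the images
-- pulls back.
mapSomeSum : ∀ {A B : Set} {_∙_ : A → A → A} {_◦_ : B → B → B}
             {P : A → Set} {Q : B → Set} (f : A → B) →
             (∀ a b → f (a ∙ b) ≡ f a ◦ f b) → (∀ {a} → Q (f a) → P a) →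
             ∀ {a b c} → SomeSum _◦_ Q (f a) (f b) (f c) → SomeSum _∙_ P a b c
mapSomeSum {_∙_ = _∙_} {_◦_} {P} {Q} f homo reflect {a} {b} {c} =
  Sum.map reflect (Sum.map reflect (Sum.map reflect
    (Sum.map two (Sum.map two (Sum.map two three)))))
  where
  two : ∀ {a b} → Q (f a ◦ f b) → P (a ∙ b)
  two {a} {b} q = reflect (subst Q (sym (homo a b)) q)

  three : Q (f a ◦ (f b ◦ f c)) → P (a ∙ (b ∙ c))
  three q = two (subst (λ x → Q (f a ◦ x)) (sym (homo b c)) q)

_+₂_ : Fin 2 → Fin 2 → Fin 2
zero     +₂ j        = j
suc zero +₂ zero     = suc zero
suc zero +₂ suc zero = zero

Zero₂ : Fin 2 × Fin 2 → Set
Zero₂ (i , j) = i ≡ zero × j ≡ zero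

_+₂²_ : Fin 2 × Fin 2 → Fin 2 × Fin 2 → Fin 2 × Fin 2
(i , j) +₂² (k , l) = (i +₂ k) , (j +₂ l)

-- Three vectors in a plane are dependent; over two elements this is decided by running through all
-- 64 triples.
dependent₂ : ∀ x y z → SomeSum _+₂²_ Zero₂ x y z
dependent₂ (i , j) (k , l) (m , n) = from-yes
  (all? λ i → all? λ j → all? λ k → all? λ l → all? λ m → all? λ n →
   zero? (i , j) ⊎-dec zero? (k , l) ⊎-dec zero? (m , n) ⊎-dec
   zero? ((i , j) +₂² (k , l)) ⊎-dec zero? ((i , j) +₂² (m , n)) ⊎-dec
   zero? ((k , l) +₂² (m , n)) ⊎-dec zero? ((i , j) +₂² ((k , l) +₂² (m , n))))
  i j k l m n
  where
  zero? : Decidable Zero₂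
  zero? (i , j) = (i Fin.≟ zero) ×-dec (j Fin.≟ zero)

2∤⇒2∣1+ : ∀ z → ¬ (+ 2 ∣ₛ z) → + 2 ∣ₛ + 1 ℤ.+ z
2∤⇒2∣1+ z 2∤z with z %ℕ 2 | z /ℕ 2 | a≡a%ℕn+[a/ℕn]*n z 2 | n%ℕd<d z 2
... | 0 | q | z≡ | _ = ⊥-elim (2∤z (divides q (trans z≡ (ℤ.+-identityˡ _))))
... | 1 | q | z≡ | _ = divides (+ 1 ℤ.+ q) (trans (cong (ℤ._+_ (+ 1)) z≡)
  (solve 1 (λ q → con (+ 1) :+ (con (+ 1) :+ q :* con (+ 2)) := (con (+ 1) :+ q) :* con (+ 2)) refl q))
  where open ℤSolver
... | suc (suc _) | _ | _ | s≤s (s≤s ())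

parity : ℤ → Fin 2
parity z with + 2 ∣ₛ? z
... | yes _ = zero
... | no  _ = suc zero

parity≡0⇒2∣ : ∀ z → parity z ≡ zero → + 2 ∣ₛ z
parity≡0⇒2∣ z p with + 2 ∣ₛ? z
... | yes 2∣z = 2∣z
... | no  _ with () ← p

parity-+ : ∀ x y → parity (x ℤ.+ y) ≡ parity x +₂ parity y
parity-+ x y with + 2 ∣ₛ? x | + 2 ∣ₛ? y | + 2 ∣ₛ? (x ℤ.+ y)
... | yes _   | yes _   | yes _     = refl
... | yes 2∣x | yes 2∣y | no  2∤x+y = ⊥-elim (2∤x+y (∣m∣n⇒∣m+n 2∣x 2∣y))
... | yes 2∣x | no  2∤y | yes 2∣x+y = ⊥-elim (2∤y (∣m+n∣m⇒∣n 2∣x+y 2∣x))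
... | yes _   | no  _   | no  _     = refl
... | no  2∤x | yes 2∣y | yes 2∣x+y = ⊥-elim (2∤x (∣m+n∣n⇒∣m 2∣x+y 2∣y))
... | no  _   | yes _   | no  _     = refl
... | no  _   | no  _   | yes _     = refl
... | no  2∤x | no  2∤y | no  2∤x+y = ⊥-elim (2∤x+y (∣m+n∣m⇒∣n {m = + 2}
  (subst (+ 2 ∣ₛ_) (solve 2 (λ x y → (con (+ 1) :+ x) :+ (con (+ 1) :+ y) := con (+ 2) :+ (x :+ y)) refl x y)
    (∣m∣n⇒∣m+n (2∤⇒2∣1+ x 2∤x) (2∤⇒2∣1+ y 2∤y))) ∣-refl))
  where open ℤSolver

-- Coordinates modulo 2, padded with zeros so that the ranks 0, 1 and 2 share one target plane.
firstTwoParities : ∀ r → (Fin r → ℤ) → Fin 2 × Fin 2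
firstTwoParities 0             z = zero , zero
firstTwoParities 1             z = parity (z zero) , zero
firstTwoParities (suc (suc r)) z = parity (z zero) , parity (z (suc zero))

firstTwoParities-+ : ∀ r (x y : Fin r → ℤ) {z} → (∀ i → z i ≡ x i ℤ.+ y i) →
                     firstTwoParities r z ≡ firstTwoParities r x +₂² firstTwoParities r y
firstTwoParities-+ 0             x y z≡x+y = refl
firstTwoParities-+ 1             x y z≡x+y =
  cong (_, zero) (trans (cong parity (z≡x+y zero)) (parity-+ (x zero) (y zero)))
firstTwoParities-+ (suc (suc r)) x y z≡x+y = cong₂ _,_
  (trans (cong parity (z≡x+y zero)) (parity-+ (x zero) (y zero)))
  (trans (cong parity (z≡x+y (suc zero))) (parity-+ (x (suc zero)) (y (suc zero))))

-- The bound on `r` guarantees that no coordinate has been cut off.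
firstTwoParities≡0⇒2∣ : ∀ {r} → r ℕ.< 3 → (z : Fin r → ℤ) → Zero₂ (firstTwoParities r z) →
                        ∀ i → + 2 ∣ₛ z i
firstTwoParities≡0⇒2∣ {1} _ z (p , _) zero       = parity≡0⇒2∣ (z zero) p
firstTwoParities≡0⇒2∣ {2} _ z (p , _) zero       = parity≡0⇒2∣ (z zero) p
firstTwoParities≡0⇒2∣ {2} _ z (_ , p) (suc zero) = parity≡0⇒2∣ (z (suc zero)) p
firstTwoParities≡0⇒2∣ {suc (suc (suc _))} (s≤s (s≤s (s≤s ())))

-- If r < 3, parities of the free part map `G` to a plane over two elements, where the three images
-- are dependent. Whatever is sent to zero is a double, which contradicts independence. As `G` is
-- raw, group computations take place in `ℤ^ r ⊞ T` and are pulled back along `f`.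
rank≥3 : ∀ {G : RawGroup 0ℓ 0ℓ} {r} (T : AbelianGroup 0ℓ 0ℓ) → Finite T →
         G ≅ AbelianGroup.rawGroup (ℤ^ r ⊞ T) → NoTwoTorsion G →
         ∀ {a b c} → ¬ SomeSum (RawGroup._∙_ G) (Double G) a b c → 3 ≤ r
rank≥3 {G} {r} T T-finite (f , f-iso) noTwoTorsion independent =
  ℕ.≮⇒≥ λ r<3 → independent (mapSomeSum {_◦_ = _+₂²_} {Q = Zero₂} (firstTwoParities r ∘ proj₁ ∘ f)
    (λ a b → firstTwoParities-+ r _ _ (proj₁ (homo a b)))
    (λ {g} p → halve g (firstTwoParities≡0⇒2∣ r<3 _ p))
    (dependent₂ _ _ _))
  where
  module G = RawGroup G
  module T = AbelianGroup T
  module H = AbelianGroup (ℤ^ r ⊞ T)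
  open GroupMorphisms G H.rawGroup using (IsGroupIsomorphism)
  open IsGroupIsomorphism f-iso using (ε-homo; injective; surjective; ⟦⟧-cong) renaming (∙-homo to homo)

  preimage : ∀ h → ∃ λ g → f g H.≈ h
  -- A raw group carries no reflexivity; `injective H.refl` supplies it at the witness.
  preimage h = proj₁ (surjective h) , proj₂ (surjective h) (injective H.refl)

  double-reflect : ∀ {g g′} → f g H.∙ f g H.≈ f g′ → g G.∙ g G.≈ g′
  double-reflect fg∙fg≈fg′ = injective (H.trans (homo _ _) fg∙fg≈fg′)

  -- The preimage of the pair (0, t) is killed by doubling in `G`, hence trivial.
  T-noTwoTorsion : NoTwoTorsion T.rawGroup
  T-noTwoTorsion t tt≈ε =
    let g , fg≈0,t = preimage ((λ _ → + 0) , t)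
        g≈ε = noTwoTorsion g (double-reflect
                (H.trans (H.∙-cong fg≈0,t fg≈0,t)
                (H.trans ((λ _ → refl) , tt≈ε) (H.sym ε-homo))))
    in proj₂ (H.trans (H.sym fg≈0,t) (H.trans (⟦⟧-cong g≈ε) ε-homo))

  -- The free part is halved coordinatewise, the torsion part by `finite⇒double`; the preimage of
  -- the resulting pair is the required half.
  halve : ∀ g → (∀ i → + 2 ∣ₛ proj₁ (f g) i) → Double G g
  halve g even =
    let s , ss≈t = finite⇒double T T-finite T-noTwoTorsion (proj₂ (f g))
        z = λ i → quotient (even i)
        h , fh≈z,s = preimage (z , s)
    in h , double-reflect (H.trans (H.∙-cong fh≈z,s fh≈z,s)
             ((λ i → trans (solve 1 (λ q → q :+ q := q :* con (+ 2)) refl (z i))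
                           (sym (ℤ∣._∣_.equality (even i)))) , ss≈t))
    where open ℤSolver

-- The duplication formula modulo 3 and modulo 16

module _ where

  open import Data.Integer.Base using (_+_; _*_; _-_; -_; _^_)
  open ℤSolver

  2∣n⊎2∣n²-1 : ∀ n → + 2 ∣ₛ n ⊎ + 2 ∣ₛ n * n - + 1
  2∣n⊎2∣n²-1 n with + 2 ∣ₛ? n
  ... | yes 2∣n = inj₁ 2∣n
  ... | no  2∤n = inj₂ (subst (+ 2 ∣ₛ_)
    (solve 1 (λ n → (n :- con (+ 1)) :* (con (+ 1) :+ n) := n :* n :- con (+ 1)) refl n)
    (∣n⇒∣m*n (n - + 1) (2∤⇒2∣1+ n 2∤n)))

  3∣n⊎3∣n²-1 : ∀ n → + 3 ∣ₛ n ⊎ + 3 ∣ₛ n * n - + 1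
  3∣n⊎3∣n²-1 n with n %ℕ 3 | n /ℕ 3 | a≡a%ℕn+[a/ℕn]*n n 3 | n%ℕd<d n 3
  ... | 0 | q | refl | _ = inj₁ (divides q (ℤ.+-identityˡ _))
  ... | 1 | q | refl | _ = inj₂ (divides (+ 2 * q + + 3 * q * q)
    (solve 1 (λ q → (con (+ 1) :+ q :* con (+ 3)) :* (con (+ 1) :+ q :* con (+ 3)) :- con (+ 1)
       := (con (+ 2) :* q :+ con (+ 3) :* q :* q) :* con (+ 3)) refl q))
  ... | 2 | q | refl | _ = inj₂ (divides (+ 1 + + 4 * q + + 3 * q * q)
    (solve 1 (λ q → (con (+ 2) :+ q :* con (+ 3)) :* (con (+ 2) :+ q :* con (+ 3)) :- con (+ 1)
       := (con (+ 1) :+ con (+ 4) :* q :+ con (+ 3) :* q :* q) :* con (+ 3)) refl q))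
  ... | suc (suc (suc _)) | _ | _ | s≤s (s≤s (s≤s ()))

  3∣n³-n : ∀ n → + 3 ∣ₛ n * n * n - n
  3∣n³-n n with 3∣n⊎3∣n²-1 n
  ... | inj₁ 3∣n    = ∣m∣n⇒∣m-n (∣n⇒∣m*n (n * n) 3∣n) 3∣n
  ... | inj₂ 3∣n²-1 = subst (+ 3 ∣ₛ_)
    (solve 1 (λ n → n :* (n :* n :- con (+ 1)) := n :* n :* n :- n) refl n) (∣n⇒∣m*n n 3∣n²-1)

  -- The equation X = ((x² + 1)² − 8bx) / 4(x³ − x + b) between the abscissas X = n/d and x = p/q
  -- of a double 2S and of S on y² = x³ − x + b, with denominators cleared.
  Duplication : (b d n p q : ℤ) → Set
  Duplication b d n p q =
    n * (+ 4 * (p * p * p * q - p * (q * q * q) + b * (q * q * q * q))) ≡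
    d * ((p * p + q * q) * (p * p + q * q) - + 8 * (b * (p * (q * q * q))))

  module _ {b d n p q} (dup : Duplication b d n p q) where

    private
      N A : ℤ
      N = n * (+ 4 * (p * p * p * q - p * (q * q * q) + b * (q * q * q * q)))
      A = p * p + q * q

    -- Modulo k, d is 1 and the term with 8b vanishes, so the right side of `Duplication` reduces to
    -- the square of p² + q², while the left side is `N`.
    divides-square : ∀ {k} → k ∣ₛ d - + 1 → k ∣ₛ N → k ∣ₛ + 8 * b → k ∣ₛ A * A
    divides-square {k} k∣d-1 k∣N k∣8b = subst (k ∣ₛ_)
      (trans (cong (λ x → x - (d - + 1) * (A * A) + + 8 * b * (d * (p * (q * q * q)))) dup)
        (solve 4 (λ b d p q →
          let A = p :* p :+ q :* q in
          d :* (A :* A :- con (+ 8) :* (b :* (p :* (q :* q :* q))))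
            :- (d :- con (+ 1)) :* (A :* A) :+ con (+ 8) :* b :* (d :* (p :* (q :* q :* q)))
          := A :* A) refl b d p q))
      (∣m∣n⇒∣m+n (∣m∣n⇒∣m-n k∣N (∣m⇒∣m*n (A * A) k∣d-1)) (∣m⇒∣m*n _ k∣8b))

  square-unit : ∀ {k} s → k ∣ₛ s - + 1 → k ∣ₛ s * s → k ∣ₛ + 1
  square-unit {k} s k∣s-1 k∣s² = subst (k ∣ₛ_)
    (solve 1 (λ s → s :* s :- (s :+ con (+ 1)) :* (s :- con (+ 1)) := con (+ 1)) refl s)
    (∣m∣n⇒∣m-n k∣s² (∣n⇒∣m*n (s + + 1) k∣s-1))

  one-divides : ∀ {k} p q → k ∣ₛ p → k ∣ₛ q * q - + 1 →
                k ∣ₛ (p * p + q * q) * (p * p + q * q) → k ∣ₛ + 1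
  one-divides {k} p q k∣p k∣q²-1 = square-unit (p * p + q * q) (subst (k ∣ₛ_)
    (solve 2 (λ p q → p :* p :+ (q :* q :- con (+ 1)) := p :* p :+ q :* q :- con (+ 1)) refl p q)
    (∣m∣n⇒∣m+n (∣n⇒∣m*n p k∣p) k∣q²-1))

  3∤1 : ¬ (+ 3 ∣ₛ + 1)
  3∤1 = from-no (+ 3 ∣ₛ? + 1)

  -- The left side is divisible by 3, because p³q - pq³ = (p³ - p)q - p(q³ - q) and 3 ∣ b. Hence 3
  -- divides p² + q² squared, and as -1 is not a square modulo 3, it divides both p and q.
  noDuplication₃ : ∀ {b d n p q} → + 3 ∣ₛ b → + 3 ∣ₛ d - + 1 → ¬ (+ 3 ∣ₛ p × + 3 ∣ₛ q) →
                   ¬ Duplication b d n p q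
  noDuplication₃ {b} {d} {n} {p} {q} 3∣b 3∣d-1 coprime dup =
    contra (3∣n⊎3∣n²-1 p) (3∣n⊎3∣n²-1 q)
    where
    A = p * p + q * q

    3∣A² : + 3 ∣ₛ A * A
    3∣A² = divides-square {b} {d} {n} {p} {q} dup 3∣d-1
      (∣n⇒∣m*n n (∣n⇒∣m*n (+ 4) (∣m∣n⇒∣m+n
        (subst (+ 3 ∣ₛ_)
          (solve 2 (λ p q → (p :* p :* p :- p) :* q :- p :* (q :* q :* q :- q)
                            := p :* p :* p :* q :- p :* (q :* q :* q)) refl p q)
          (∣m∣n⇒∣m-n (∣m⇒∣m*n q (3∣n³-n p)) (∣n⇒∣m*n p (3∣n³-n q))))
        (∣m⇒∣m*n (q * q * q * q) 3∣b))))
      (∣n⇒∣m*n (+ 8) 3∣b)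

    contra : + 3 ∣ₛ p ⊎ + 3 ∣ₛ p * p - + 1 → + 3 ∣ₛ q ⊎ + 3 ∣ₛ q * q - + 1 → ⊥
    contra (inj₁ 3∣p) (inj₁ 3∣q) = coprime (3∣p , 3∣q)
    contra (inj₁ 3∣p) (inj₂ 3∣q²-1) = 3∤1 (one-divides p q 3∣p 3∣q²-1 3∣A²)
    contra (inj₂ 3∣p²-1) (inj₁ 3∣q) =
      3∤1 (one-divides q p 3∣q 3∣p²-1 (subst (λ s → + 3 ∣ₛ s * s) (ℤ.+-comm (p * p) (q * q)) 3∣A²))
    -- Here p² + q² is 2 modulo 3, so its negative is 1.
    contra (inj₂ 3∣p²-1) (inj₂ 3∣q²-1) = 3∤1 (square-unit (- A)
      (subst (+ 3 ∣ₛ_)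
        (solve 2 (λ x y → :- con (+ 3) :- (x :- con (+ 1)) :- (y :- con (+ 1)) := :- (x :+ y) :- con (+ 1))
          refl (p * p) (q * q))
        (∣m∣n⇒∣m-n (∣m∣n⇒∣m-n (divides (- + 1) refl) 3∣p²-1) 3∣q²-1))
      (subst (+ 3 ∣ₛ_) (solve 1 (λ s → s :* s := :- s :* :- s) refl A) 3∣A²))

  -- Divided by 4, the two sides are (1 + 4n)(1 + 4α) and (1 + 4d)(4δ − 1), so they differ modulo 4.
  noDuplication-odd : ∀ b d n i j → ¬ Duplication (+ 1 + b * + 4) (+ 1 + d * + 4) (+ 1 + n * + 4)
                                                  (+ 1 + i * + 2) (+ 1 + j * + 2)
  noDuplication-odd b d n i j dup = from-no (+ 16 ∣ₛ? - + 8) (divides W (begin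
    - + 8
      ≡⟨ cong (_+_ (- + 8)) (ℤ.i≡j⇒i-j≡0 dup) ⟨
    _
      ≡⟨ solve 5 (λ b d n i j →
           let 1+_*4 = λ x → con (+ 1) :+ x :* con (+ 4)
               b′ = 1+ b *4
               d′ = 1+ d *4
               n′ = 1+ n *4
               p = con (+ 1) :+ i :* con (+ 2)
               q = con (+ 1) :+ j :* con (+ 2)
               -- p² = 1 + 4I, q² = 1 + 4J, pq = 1 + 2K and b′q² = 1 + 4e. Then p³q - pq³ + b′q⁴ = 1
               -- + 4α and (p² + q²)² - 8b′pq³ = 4(4δ - 1), so the two sides differ by 8 modulo 16.
               I = i :* i :+ i
               J = j :* j :+ j
               K = i :+ j :+ con (+ 2) :* (i :* j)
               e = b :+ J :+ con (+ 4) :* (b :* J)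
               pq = con (+ 1) :+ con (+ 2) :* K
               α = pq :* (I :- J) :+ b :* (1+ J *4 :* 1+ J *4) :+ con (+ 2) :* J :+ con (+ 4) :* (J :* J)
               δ = I :+ J :+ (I :+ J) :* (I :+ J) :- (K :+ con (+ 2) :* e :* pq)
           in
           con (- + 8) :+ (n′ :* (con (+ 4) :* (p :* p :* p :* q :- p :* (q :* q :* q) :+ b′ :* (q :* q :* q :* q)))
             :- d′ :* ((p :* p :+ q :* q) :* (p :* p :+ q :* q) :- con (+ 8) :* (b′ :* (p :* (q :* q :* q)))))
           := (α :+ n :+ con (+ 4) :* (n :* α) :- δ :+ d :- con (+ 4) :* (d :* δ)) :* con (+ 16))
           refl b d n i j ⟩
    W * + 16 ∎))
    where
    open ≡-Reasoning
    W = let I = i * i + i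
            J = j * j + j
            K = i + j + + 2 * (i * j)
            e = b + J + + 4 * (b * J)
            pq = + 1 + + 2 * K
            J′ = + 1 + J * + 4
            α = pq * (I - J) + b * (J′ * J′) + + 2 * J + + 4 * (J * J)
            δ = I + J + (I + J) * (I + J) - (K + + 2 * e * pq)
        in α + n + + 4 * (n * α) - δ + d - + 4 * (d * δ)

  ∣n-1⇒n≡1+qk : ∀ {k n} → k ∣ₛ n - + 1 → ∃ λ q → n ≡ + 1 + q * k
  ∣n-1⇒n≡1+qk {k} {n} (divides q n-1≡qk) = q , trans
    (solve 1 (λ n → n := con (+ 1) :+ (n :- con (+ 1))) refl n)
    (cong (_+_ (+ 1)) n-1≡qk)

  odd⇒2∣n-1 : ∀ n → ¬ (+ 2 ∣ₛ n) → + 2 ∣ₛ n - + 1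
  odd⇒2∣n-1 n 2∤n = subst (+ 2 ∣ₛ_)
    (solve 1 (λ n → con (+ 1) :+ n :- con (+ 2) := n :- con (+ 1)) refl n)
    (∣m∣n⇒∣m-n (2∤⇒2∣1+ n 2∤n) ∣-refl)

  2∤1 : ¬ (+ 2 ∣ₛ + 1)
  2∤1 = from-no (+ 2 ∣ₛ? + 1)

  -- The factor 4 makes p² + q² even, so coprime p and q are both odd, and the comparison modulo 16
  -- applies.
  noDuplication₂ : ∀ {b d n p q} → + 4 ∣ₛ b - + 1 → + 4 ∣ₛ d - + 1 → + 4 ∣ₛ n - + 1 →
                   ¬ (+ 2 ∣ₛ p × + 2 ∣ₛ q) → ¬ Duplication b d n p q
  noDuplication₂ {b} {d} {n} {p} {q} 4∣b-1 4∣d-1 4∣n-1 coprime dup =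
    contra (+ 2 ∣ₛ? p) (+ 2 ∣ₛ? q)
    where
    2∣A² : + 2 ∣ₛ (p * p + q * q) * (p * p + q * q)
    2∣A² = divides-square {b} {d} {n} {p} {q} dup
      (∣-trans (divides (+ 2) refl) 4∣d-1)
      (∣n⇒∣m*n n (∣m⇒∣m*n _ (divides (+ 2) refl)))
      (∣m⇒∣m*n b (divides (+ 4) refl))

    odd⇒2∣n²-1 : ∀ n → ¬ (+ 2 ∣ₛ n) → + 2 ∣ₛ n * n - + 1
    odd⇒2∣n²-1 n 2∤n = Sum.[ ⊥-elim ∘ 2∤n , id ]′ (2∣n⊎2∣n²-1 n)

    -- Residues given as equations between variables and expressions can be substituted by `refl`,
    -- which brings the equation into the form of `noDuplication-odd`.
    odd-case : ∀ {b d n p q} → (∃ λ b′ → b ≡ + 1 + b′ * + 4) → (∃ λ d′ → d ≡ + 1 + d′ * + 4) →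
               (∃ λ n′ → n ≡ + 1 + n′ * + 4) → (∃ λ i → p ≡ + 1 + i * + 2) →
               (∃ λ j → q ≡ + 1 + j * + 2) → ¬ Duplication b d n p q
    odd-case (b′ , refl) (d′ , refl) (n′ , refl) (i , refl) (j , refl) =
      noDuplication-odd b′ d′ n′ i j

    contra : Dec (+ 2 ∣ₛ p) → Dec (+ 2 ∣ₛ q) → ⊥
    contra (yes 2∣p) (yes 2∣q) = coprime (2∣p , 2∣q)
    contra (yes 2∣p) (no  2∤q) = 2∤1 (one-divides p q 2∣p (odd⇒2∣n²-1 q 2∤q) 2∣A²)
    contra (no  2∤p) (yes 2∣q) = 2∤1 (one-divides q p 2∣q (odd⇒2∣n²-1 p 2∤p)
      (subst (λ s → + 2 ∣ₛ s * s) (ℤ.+-comm (p * p) (q * q)) 2∣A²))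
    contra (no  2∤p) (no  2∤q) = odd-case {b} {d} {n} {p} {q}
      (∣n-1⇒n≡1+qk 4∣b-1) (∣n-1⇒n≡1+qk 4∣d-1) (∣n-1⇒n≡1+qk 4∣n-1)
      (∣n-1⇒n≡1+qk (odd⇒2∣n-1 p 2∤p)) (∣n-1⇒n≡1+qk (odd⇒2∣n-1 q 2∤q)) dup

  -- For odd q the form is bq³, hence odd, since p(p² - q²) is even; for even q it is p³ modulo 2,
  -- and p is odd.
  noRoot : ∀ {b p q} → + 2 ∣ₛ b - + 1 → ¬ (+ 2 ∣ₛ p × + 2 ∣ₛ q) →
           p * p * p - p * (q * q) + b * (q * q * q) ≢ + 0
  noRoot {b} {p} {q} 2∣b-1 coprime root = contra (2∣n⊎2∣n²-1 p) (2∣n⊎2∣n²-1 q)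
    where
    F = p * p * p - p * (q * q) + b * (q * q * q)

    2∣*F : ∀ r → + 2 ∣ₛ r * F
    2∣*F r = ∣n⇒∣m*n r (subst (+ 2 ∣ₛ_) (sym root) (divides (+ 0) refl))

    q-odd : + 2 ∣ₛ p * p - q * q ⊎ + 2 ∣ₛ p → + 2 ∣ₛ q * q - + 1 → ⊥
    -- Multiplying the form by q turns bq³ into bq⁴, which is 1 modulo 2 by q² ≡ 1 alone; the factor
    -- p serves likewise for even q.
    q-odd e 2∣q²-1 = 2∤1 (subst (+ 2 ∣ₛ_)
      (solve 3 (λ b p q →
         q :* (p :* p :* p :- p :* (q :* q) :+ b :* (q :* q :* q)) :- p :* (p :* p :- q :* q) :* q
           :- (b :- con (+ 1)) :* (q :* q :* q :* q) :- (q :* q :+ con (+ 1)) :* (q :* q :- con (+ 1))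
         := con (+ 1)) refl b p q)
      (∣m∣n⇒∣m-n (∣m∣n⇒∣m-n (∣m∣n⇒∣m-n (2∣*F q) (∣m⇒∣m*n q 2∣p[p²-q²]))
        (∣m⇒∣m*n (q * q * q * q) 2∣b-1)) (∣n⇒∣m*n (q * q + + 1) 2∣q²-1)))
      where
      2∣p[p²-q²] : + 2 ∣ₛ p * (p * p - q * q)
      2∣p[p²-q²] = Sum.[ ∣n⇒∣m*n p , ∣m⇒∣m*n (p * p - q * q) ]′ e

    contra : + 2 ∣ₛ p ⊎ + 2 ∣ₛ p * p - + 1 → + 2 ∣ₛ q ⊎ + 2 ∣ₛ q * q - + 1 → ⊥
    contra (inj₁ 2∣p)    (inj₁ 2∣q)    = coprime (2∣p , 2∣q)
    contra (inj₁ 2∣p)    (inj₂ 2∣q²-1) = q-odd (inj₂ 2∣p) 2∣q²-1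
    contra (inj₂ 2∣p²-1) (inj₂ 2∣q²-1) = q-odd (inj₁ (subst (+ 2 ∣ₛ_)
      (solve 2 (λ x y → (x :- con (+ 1)) :- (y :- con (+ 1)) := x :- y) refl (p * p) (q * q))
      (∣m∣n⇒∣m-n 2∣p²-1 2∣q²-1))) 2∣q²-1
    contra (inj₂ 2∣p²-1) (inj₁ 2∣q)    = 2∤1 (subst (+ 2 ∣ₛ_)
      (solve 3 (λ b p q →
         p :* (p :* p :* p :- p :* (q :* q) :+ b :* (q :* q :* q))
           :- p :* (b :* (q :* q) :- p :* q) :* q :- (p :* p :+ con (+ 1)) :* (p :* p :- con (+ 1))
         := con (+ 1)) refl b p q)
      (∣m∣n⇒∣m-n (∣m∣n⇒∣m-n (2∣*F p) (∣n⇒∣m*n (p * (b * (q * q) - p * q)) 2∣q))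
        (∣n⇒∣m*n (p * p + + 1) 2∣p²-1)))

  odd⇒4∣m²-1 : ∀ m → ¬ (+ 2 ∣ₛ m) → + 4 ∣ₛ m * m - + 1
  odd⇒4∣m²-1 m 2∤m with ∣n-1⇒n≡1+qk {n = m} (odd⇒2∣n-1 m 2∤m)
  ... | q , refl = divides (q * q + q)
    (solve 1 (λ q → let m = con (+ 1) :+ q :* con (+ 2) in
       m :* m :- con (+ 1) := (q :* q :+ q) :* con (+ 4)) refl q)

  odd⇒4∣m⁶-1 : ∀ m → ¬ (+ 2 ∣ₛ m) → + 4 ∣ₛ m ^ 6 - + 1
  odd⇒4∣m⁶-1 m 2∤m = subst (+ 4 ∣ₛ_)
    (solve 1 (λ m → (m :* m :- con (+ 1)) :* (m :* m :* (m :* m) :+ m :* m :+ con (+ 1))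
                    := m :^ 6 :- con (+ 1)) refl m)
    (∣m⇒∣m*n (m * m * (m * m) + m * m + + 1) (odd⇒4∣m²-1 m 2∤m))

-- Abscissas of sums of rational points

module _ where

  open import Data.Rational.Base using (_+_; _*_; _-_; -_; _÷_; 1/_)

  fromℤ-injective : ∀ {i j} → fromℤ i ≡ fromℤ j → i ≡ j
  fromℤ-injective = cong ↥_

  fromℤ-neg : ∀ i → fromℤ (ℤ.- i) ≡ - fromℤ i
  fromℤ-neg i = ℚ.toℚᵘ-injective (ℚᵘ.≃-sym (ℚ.toℚᵘ-homo‿- (fromℤ i)))

  -- A proof that fromℤ commutes with the operations of an expression has the shape of that
  -- expression, with ⟪_⟫ at its leaves.
  infix  8 ⟪_⟫
  infixl 7 _⟨*⟩_
  infixl 6 _⟨+⟩_ _⟨-⟩_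

  ⟪_⟫ : ∀ i → fromℤ i ≡ fromℤ i
  ⟪ _ ⟫ = refl

  _⟨+⟩_ : ∀ {i j x y} → fromℤ i ≡ x → fromℤ j ≡ y → fromℤ (i ℤ.+ j) ≡ x + y
  _⟨+⟩_ {i} {j} refl refl = fromℤ-+ i j

  _⟨*⟩_ : ∀ {i j x y} → fromℤ i ≡ x → fromℤ j ≡ y → fromℤ (i ℤ.* j) ≡ x * y
  _⟨*⟩_ {i} {j} refl refl = fromℤ-* i j

  _⟨-⟩_ : ∀ {i j x y} → fromℤ i ≡ x → fromℤ j ≡ y → fromℤ (i ℤ.- j) ≡ x - y
  _⟨-⟩_ {i} {j} refl refl = trans (fromℤ-+ i (ℤ.- j)) (cong (_+_ (fromℤ i)) (fromℤ-neg j))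

  x*↧x≡↥x : ∀ x → x * fromℤ (↧ x) ≡ fromℤ (↥ x)
  x*↧x≡↥x x@record{} = ℚ.toℚᵘ-injective (ℚᵘ.≃-trans (ℚ.toℚᵘ-homo-* x (fromℤ (↧ x)))
    (ℚᵘ.*≡* (trans (ℤ.*-identityʳ _) (cong (↥ x ℤ.*_) (sym (ℤ.*-identityʳ (↧ x)))))))

  -- The coprimality proof inside a rational is irrelevant; deciding whether |k| = 1 makes its
  -- consequence usable.
  ↥↧-coprime : ∀ {k} x → ¬ (k ∣ₛ + 1) → ¬ (k ∣ₛ ↥ x × k ∣ₛ ↧ x)
  ↥↧-coprime {k} (mkℚ p q-1 c) k∤1 (k∣p , k∣q) =
    k∤1 (∣ᵤ⇒∣ (ℕ.∣-reflexive (recompute (ℤ.∣ k ∣ ℕ.≟ 1) (c (∣⇒∣ᵤ k∣p , ∣⇒∣ᵤ k∣q)))))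

  -- Recovers the curve equation, which is an irrelevant field of a point.
  ≟-recompute : ∀ {x y : ℚ} → .(x ≡ y) → x ≡ y
  ≟-recompute {x} {y} = recompute (x ℚ.≟ y)

  module _ (E : EllipticCurve) where

    open EllipticCurve E

    -- The abscissa n/d is cross-multiplied to avoid division; the value at `∞` makes the predicate
    -- include being affine.
    HasAbscissa : Point E → ℚ → ℚ → Set
    HasAbscissa ∞           n d = ⊥
    HasAbscissa (aff x _ _) n d = x * d ≡ n

    aff-cong : ∀ {x y x′ y′} .{on : OnCurve E x y} .{on′ : OnCurve E x′ y′} →
               x ≡ x′ → y ≡ y′ → aff x y on ≡ aff {E} x′ y′ on′
    aff-cong refl refl = refl

    -- The graph of `_⊕_` on affine points: matching on it distinguishes the geometric cases without
    -- repeating the `with` of `_⊕_`.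
    data Addition x₁ y₁ x₂ y₂ .(on₁ : OnCurve E x₁ y₁) .(on₂ : OnCurve E x₂ y₂) : Point E → Set where
      secant   : (x₁≢x₂ : x₁ ≢ x₂) →
                 Addition x₁ y₁ x₂ y₂ on₁ on₂
                   (chord E x₁ y₁ x₂ y₂ on₁ on₂ {{chord-nonZero E x₁ x₂ x₁≢x₂}})
      vertical : x₁ ≡ x₂ → y₁ ≡ - y₂ → Addition x₁ y₁ x₂ y₂ on₁ on₂ ∞
      doubling : (x₁≡x₂ : x₁ ≡ x₂) (y₁≢-y₂ : y₁ ≢ - y₂) →
                 Addition x₁ y₁ x₂ y₂ on₁ on₂
                   (tangent E x₁ y₁ on₁ {{tangent-nonZero E x₁ y₁ x₂ y₂ on₁ on₂ x₁≡x₂ y₁≢-y₂}})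

    addition : ∀ {x₁ y₁ x₂ y₂} .(on₁ : OnCurve E x₁ y₁) .(on₂ : OnCurve E x₂ y₂) →
               Addition x₁ y₁ x₂ y₂ on₁ on₂ (_⊕_ E (aff x₁ y₁ on₁) (aff x₂ y₂ on₂))
    addition {x₁} {y₁} {x₂} {y₂} on₁ on₂ with x₁ ℚ.≟ x₂ | y₁ ℚ.≟ - y₂
    ... | no  x₁≢x₂ | _         = secant x₁≢x₂
    ... | yes x₁≡x₂ | yes y₁≡-y₂ = vertical x₁≡x₂ y₁≡-y₂
    ... | yes x₁≡x₂ | no  y₁≢-y₂ = doubling x₁≡x₂ y₁≢-y₂

    secant-abscissa : ∀ {x₁ y₁ x₂ y₂} .{on₁ : OnCurve E x₁ y₁} .{on₂ : OnCurve E x₂ y₂} {P} →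
      Addition x₁ y₁ x₂ y₂ on₁ on₂ P → x₁ ≢ x₂ → let d = x₂ - x₁ ; e = y₂ - y₁ in
      HasAbscissa P (e * e - (x₁ + x₂) * (d * d)) (d * d)
    secant-abscissa (vertical x₁≡x₂ _) x₁≢x₂ = ⊥-elim (x₁≢x₂ x₁≡x₂)
    secant-abscissa (doubling x₁≡x₂ _) x₁≢x₂ = ⊥-elim (x₁≢x₂ x₁≡x₂)
    secant-abscissa {x₁} {y₁} {x₂} {y₂} (secant x₁≢x₂) _ = begin
      (l * l - x₁ - x₂) * (d * d)
        ≡⟨ solve 4 (λ l d x₁ x₂ → (l :* l :- x₁ :- x₂) :* (d :* d)
                    := (l :* d) :* (l :* d) :- (x₁ :+ x₂) :* (d :* d)) refl l d x₁ x₂ ⟩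
      (l * d) * (l * d) - (x₁ + x₂) * (d * d)
        ≡⟨ cong (λ e → e * e - (x₁ + x₂) * (d * d)) (÷-*-cancel (y₂ - y₁) d) ⟩
      (y₂ - y₁) * (y₂ - y₁) - (x₁ + x₂) * (d * d) ∎
      where
      open ≡-Reasoning
      open ℚSolver
      instance d≢0 = chord-nonZero E x₁ x₂ x₁≢x₂
      d = x₂ - x₁
      l = (y₂ - y₁) ÷ d

    -- The tangent slope satisfies l · 2y = t, so multiplying l² - 2x by 4y² removes it. The
    -- vertical case is absent because `∞` has no abscissa.
    double-abscissa : ∀ {x y n d} .{on : OnCurve E x y} {P} → Addition x y x y on on P →
      HasAbscissa P n d →
      let t = fromℤ (+ 3) * (x * x) + a in
      n * (fromℤ (+ 4) * (y * y)) ≡ d * (t * t - fromℤ (+ 8) * (x * (y * y)))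
    double-abscissa (secant x≢x) _ = ⊥-elim (x≢x refl)
    double-abscissa {x} {y} {n} {d} {on} (doubling x≡x y≢-y) X*d≡n = begin
      n * (fromℤ (+ 4) * (y * y))
        ≡⟨ cong (_* (fromℤ (+ 4) * (y * y))) X*d≡n ⟨
      (l * l - x - x) * d * (fromℤ (+ 4) * (y * y))
        ≡⟨ solve 4 (λ l d x y → let u = l :* (con (fromℤ (+ 2)) :* y) in
             (l :* l :- x :- x) :* d :* (con (fromℤ (+ 4)) :* (y :* y))
             := d :* (u :* u :- con (fromℤ (+ 8)) :* (x :* (y :* y)))) refl l d x y ⟩
      d * (l * (fromℤ (+ 2) * y) * (l * (fromℤ (+ 2) * y)) - fromℤ (+ 8) * (x * (y * y)))
        ≡⟨ cong (λ t → d * (t * t - fromℤ (+ 8) * (x * (y * y))))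
             (÷-*-cancel t (fromℤ (+ 2) * y) {{tangent-nonZero E x y x y on on x≡x y≢-y}}) ⟩
      d * (t * t - fromℤ (+ 8) * (x * (y * y))) ∎
      where
      open ≡-Reasoning
      open ℚSolver
      t = fromℤ (+ 3) * (x * x) + a
      l = _÷_ t (fromℤ (+ 2) * y) {{tangent-nonZero E x y x y on on x≡x y≢-y}}

    -- The double is `∞` only when the tangent is vertical, that is, when y = -y.
    double-∞ : ∀ {x y P} .{on : OnCurve E x y} → Addition x y x y on on P → P ≡ ∞ → y ≡ 0ℚ
    double-∞ (secant x≢x) _ = ⊥-elim (x≢x refl)
    double-∞ {y = y} (vertical _ y≡-y) _ = cancel-nonZero (fromℤ (+ 2)) y (begin
      fromℤ (+ 2) * y  ≡⟨ solve 1 (λ y → con (fromℤ (+ 2)) :* y := y :+ y) refl y ⟩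
      y + y            ≡⟨ cong (_+ y) y≡-y ⟩
      - y + y          ≡⟨ ℚ.+-inverseˡ y ⟩
      0ℚ               ∎)
      where
      open ≡-Reasoning
      open ℚSolver

  -- With y² replaced by the cubic f, the polynomial t² - 8xf becomes (x² + 1)² - 8bx;
  -- multiplication by q⁴ then homogenises.
  clear-denominators : ∀ {b x y n d p q} → y * y ≡ x * x * x + - 1ℚ * x + b → x * q ≡ p →
    let t = fromℤ (+ 3) * (x * x) + - 1ℚ in
    n * (fromℤ (+ 4) * (y * y)) ≡ d * (t * t - fromℤ (+ 8) * (x * (y * y))) →
    n * (fromℤ (+ 4) * (p * p * p * q - p * (q * q * q) + b * (q * q * q * q))) ≡
    d * ((p * p + q * q) * (p * p + q * q) - fromℤ (+ 8) * (b * (p * (q * q * q))))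
  clear-denominators {b} {x} {y} {n} {d} {q = q} on refl eq = begin
    _
      ≡⟨ solve 4 (λ b x n q → let p = x :* q in
           n :* (con (fromℤ (+ 4)) :* (p :* p :* p :* q :- p :* (q :* q :* q) :+ b :* (q :* q :* q :* q)))
           := n :* (con (fromℤ (+ 4)) :* (x :* x :* x :+ con (- 1ℚ) :* x :+ b)) :* (q :* q :* q :* q))
           refl b x n q ⟩
    n * (fromℤ (+ 4) * f) * (q * q * q * q)
      ≡⟨ cong (_* (q * q * q * q))
           (subst (λ z → n * (fromℤ (+ 4) * z) ≡ d * (t * t - fromℤ (+ 8) * (x * z))) on eq) ⟩
    d * (t * t - fromℤ (+ 8) * (x * f)) * (q * q * q * q)
      ≡⟨ solve 4 (λ b x d q →
           let p = x :* q
               A = p :* p :+ q :* q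
               f = x :* x :* x :+ con (- 1ℚ) :* x :+ b
               t = con (fromℤ (+ 3)) :* (x :* x) :+ con (- 1ℚ)
           in
           d :* (t :* t :- con (fromℤ (+ 8)) :* (x :* f)) :* (q :* q :* q :* q)
           := d :* (A :* A :- con (fromℤ (+ 8)) :* (b :* (p :* (q :* q :* q)))))
           refl b x d q ⟩
    _ ∎
    where
    open ≡-Reasoning
    open ℚSolver
    f = x * x * x + - 1ℚ * x + b
    t = fromℤ (+ 3) * (x * x) + - 1ℚ

  clear-denominators-root : ∀ {b x y p q} → y * y ≡ x * x * x + - 1ℚ * x + b → x * q ≡ p → y ≡ 0ℚ →
                            p * p * p - p * (q * q) + b * (q * q * q) ≡ 0ℚ
  clear-denominators-root {b} {x} {q = q} on refl refl = begin
    _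
      ≡⟨ solve 3 (λ b x q → let p = x :* q in
           p :* p :* p :- p :* (q :* q) :+ b :* (q :* q :* q)
           := (x :* x :* x :+ con (- 1ℚ) :* x :+ b) :* (q :* q :* q)) refl b x q ⟩
    (x * x * x + - 1ℚ * x + b) * (q * q * q)
      ≡⟨ cong (_* (q * q * q)) on ⟨
    0ℚ * 0ℚ * (q * q * q)
      ≡⟨ ℚ.*-zeroˡ (q * q * q) ⟩
    0ℚ ∎
    where
    open ≡-Reasoning
    open ℚSolver

  module _ (m : ℤ) where

    private
      b = m ℤ.^ 6

    -- The witness is the abscissa of a half of `P`, in lowest terms. That half is affine, since the
    -- double of `∞` has no abscissa.
    double⇒duplication : ∀ {d n P} → HasAbscissa (E m) P (fromℤ n) (fromℤ d) →
                         Double (rationalPoints (E m)) P → ∃ λ x → Duplication b d n (↥ x) (↧ x)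
    double⇒duplication {d} {n} ab (aff x y on , refl) = x , fromℤ-injective (begin
      fromℤ (n ℤ.* (+ 4 ℤ.* (p ℤ.* p ℤ.* p ℤ.* q ℤ.- p ℤ.* (q ℤ.* q ℤ.* q)
        ℤ.+ b ℤ.* (q ℤ.* q ℤ.* q ℤ.* q))))
        ≡⟨ ⟪ n ⟫ ⟨*⟩ (⟪ + 4 ⟫ ⟨*⟩ (P ⟨*⟩ P ⟨*⟩ P ⟨*⟩ Q ⟨-⟩ P ⟨*⟩ (Q ⟨*⟩ Q ⟨*⟩ Q)
             ⟨+⟩ ⟪ b ⟫ ⟨*⟩ (Q ⟨*⟩ Q ⟨*⟩ Q ⟨*⟩ Q))) ⟩
      _
        ≡⟨ clear-denominators {fromℤ b} {x} {y} {fromℤ n} {fromℤ d} {fromℤ p} {fromℤ q}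
             (≟-recompute on) (x*↧x≡↥x x)
             (double-abscissa (E m) (addition (E m) on on) ab) ⟩
      _
        ≡⟨ ⟪ d ⟫ ⟨*⟩ ((P ⟨*⟩ P ⟨+⟩ Q ⟨*⟩ Q) ⟨*⟩ (P ⟨*⟩ P ⟨+⟩ Q ⟨*⟩ Q)
             ⟨-⟩ ⟪ + 8 ⟫ ⟨*⟩ (⟪ b ⟫ ⟨*⟩ (P ⟨*⟩ (Q ⟨*⟩ Q ⟨*⟩ Q)))) ⟨
      fromℤ (d ℤ.* ((p ℤ.* p ℤ.+ q ℤ.* q) ℤ.* (p ℤ.* p ℤ.+ q ℤ.* q)
        ℤ.- + 8 ℤ.* (b ℤ.* (p ℤ.* (q ℤ.* q ℤ.* q))))) ∎)
      where
      open ≡-Reasoning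
      p = ↥ x
      q = ↧ x
      P = ⟪ p ⟫
      Q = ⟪ q ⟫

    -- An affine point of order 2 has y = 0, so its abscissa would be a root excluded by `noRoot`.
    noTwoTorsion : + 2 ∣ₛ b ℤ.- + 1 → NoTwoTorsion (rationalPoints (E m))
    noTwoTorsion 2∣b-1 ∞ _ = refl
    noTwoTorsion 2∣b-1 (aff x y on) 2S≡∞ = ⊥-elim (noRoot {b} {p} {q} 2∣b-1
      (↥↧-coprime x 2∤1) (fromℤ-injective (begin
      fromℤ (p ℤ.* p ℤ.* p ℤ.- p ℤ.* (q ℤ.* q) ℤ.+ b ℤ.* (q ℤ.* q ℤ.* q))
        ≡⟨ P ⟨*⟩ P ⟨*⟩ P ⟨-⟩ P ⟨*⟩ (Q ⟨*⟩ Q) ⟨+⟩ ⟪ b ⟫ ⟨*⟩ (Q ⟨*⟩ Q ⟨*⟩ Q) ⟩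
      _
        ≡⟨ clear-denominators-root {fromℤ b} {x} {y} {fromℤ p} {fromℤ q}
             (≟-recompute on) (x*↧x≡↥x x)
             (double-∞ (E m) (addition (E m) on on) 2S≡∞) ⟩
      0ℚ ∎)))
      where
      open ≡-Reasoning
      p = ↥ x
      q = ↧ x
      P = ⟪ p ⟫
      Q = ⟪ q ⟫

  -- A chord between points of equal ordinate has slope 0, so the three abscissas on it add up to 0.
  horizontal : ∀ E {x₁ x₂ y x₃ y₃} .{on₁ : OnCurve E x₁ y} .{on₂ : OnCurve E x₂ y}
               .{on₃ : OnCurve E x₃ y₃} {P} →
               Addition E x₁ y x₂ y on₁ on₂ P → x₁ ≢ x₂ → - x₁ - x₂ ≡ x₃ → - y ≡ y₃ →
               P ≡ aff x₃ y₃ on₃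
  horizontal E (vertical x₁≡x₂ _) x₁≢x₂ = ⊥-elim (x₁≢x₂ x₁≡x₂)
  horizontal E (doubling x₁≡x₂ _) x₁≢x₂ = ⊥-elim (x₁≢x₂ x₁≡x₂)
  horizontal E {x₁} {x₂} {y} (secant x₁≢x₂) _ refl refl = aff-cong E (x₃≡ _ l≡0) (y₃≡ _ _ l≡0)
    where
    open ℚSolver
    instance d≢0 = chord-nonZero E x₁ x₂ x₁≢x₂
    l≡0 : (y - y) ÷ (x₂ - x₁) ≡ 0ℚ
    l≡0 = trans (cong (_* (1/ (x₂ - x₁))) (ℚ.+-inverseʳ y)) (ℚ.*-zeroˡ (1/ (x₂ - x₁)))

    -- A variable in place of the compound slope lets `refl` substitute 0 for it.
    x₃≡ : ∀ l → l ≡ 0ℚ → l * l - x₁ - x₂ ≡ - x₁ - x₂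
    x₃≡ l refl = cong (_- x₂) (ℚ.+-identityˡ (- x₁))

    y₃≡ : ∀ l z → l ≡ 0ℚ → l * z - y ≡ - y
    y₃≡ l z refl = trans (cong (_- y) (ℚ.*-zeroˡ z)) (ℚ.+-identityˡ (- y))

  module _ (m : ℤ) where

    private
      b = m ℤ.^ 6

    onCurve : ∀ u v → v ℤ.* v ≡ u ℤ.* u ℤ.* u ℤ.+ ℤ.- (+ 1) ℤ.* u ℤ.+ b →
              OnCurve (E m) (fromℤ u) (fromℤ v)
    onCurve u v eq = trans (sym (fromℤ-* v v)) (trans (cong fromℤ eq)
      (⟪ u ⟫ ⟨*⟩ ⟪ u ⟫ ⟨*⟩ ⟪ u ⟫ ⟨+⟩ ⟪ ℤ.- (+ 1) ⟫ ⟨*⟩ ⟪ u ⟫ ⟨+⟩ ⟪ b ⟫))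

    -- The two conditions on k force the abscissas to differ: d = 0 would make k divide 1.
    integral-secant : ∀ {k} u₁ v₁ u₂ v₂ .(on₁ : OnCurve (E m) (fromℤ u₁) (fromℤ v₁))
      .(on₂ : OnCurve (E m) (fromℤ u₂) (fromℤ v₂)) → let d = u₂ ℤ.- u₁ ; e = v₂ ℤ.- v₁ in
      ¬ (k ∣ₛ + 1) → k ∣ₛ d ℤ.* d ℤ.- + 1 →
      HasAbscissa (E m) (_⊕_ (E m) (aff (fromℤ u₁) (fromℤ v₁) on₁) (aff (fromℤ u₂) (fromℤ v₂) on₂))
        (fromℤ (e ℤ.* e ℤ.- (u₁ ℤ.+ u₂) ℤ.* (d ℤ.* d))) (fromℤ (d ℤ.* d))
    integral-secant {k} u₁ v₁ u₂ v₂ on₁ on₂ k∤1 k∣d²-1 =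
      subst₂ (HasAbscissa (E m) _)
        (sym ((⟪ v₂ ⟫ ⟨-⟩ ⟪ v₁ ⟫) ⟨*⟩ (⟪ v₂ ⟫ ⟨-⟩ ⟪ v₁ ⟫) ⟨-⟩
              (⟪ u₁ ⟫ ⟨+⟩ ⟪ u₂ ⟫) ⟨*⟩ ((⟪ u₂ ⟫ ⟨-⟩ ⟪ u₁ ⟫) ⟨*⟩ (⟪ u₂ ⟫ ⟨-⟩ ⟪ u₁ ⟫))))
        (sym ((⟪ u₂ ⟫ ⟨-⟩ ⟪ u₁ ⟫) ⟨*⟩ (⟪ u₂ ⟫ ⟨-⟩ ⟪ u₁ ⟫)))
        (secant-abscissa (E m) (addition (E m) on₁ on₂) (u₁≢u₂ ∘ fromℤ-injective))
      where
      open ℤSolver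
      u₁≢u₂ : u₁ ≢ u₂
      u₁≢u₂ refl = k∤1 (subst (k ∣ₛ_)
        (solve 1 (λ u → :- ((u :- u) :* (u :- u) :- con (+ 1)) := con (+ 1)) refl u₁)
        (∣m⇒∣-m k∣d²-1))

    ¬double₃ : ∀ {d n P} → + 3 ∣ₛ b → + 3 ∣ₛ d ℤ.- + 1 → HasAbscissa (E m) P (fromℤ n) (fromℤ d) →
               ¬ Double (rationalPoints (E m)) P
    ¬double₃ {d} {n} 3∣b 3∣d-1 ab double =
      let x , dup = double⇒duplication m {d} {n} ab double
      in noDuplication₃ {b} {d} {n} {↥ x} {↧ x} 3∣b 3∣d-1 (↥↧-coprime x 3∤1) dup

    ¬double₂ : ∀ {d n P} → + 4 ∣ₛ b ℤ.- + 1 → + 4 ∣ₛ d ℤ.- + 1 → + 4 ∣ₛ n ℤ.- + 1 →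
               HasAbscissa (E m) P (fromℤ n) (fromℤ d) → ¬ Double (rationalPoints (E m)) P
    ¬double₂ {d} {n} 4∣b-1 4∣d-1 4∣n-1 ab double =
      let x , dup = double⇒duplication m {d} {n} ab double
      in noDuplication₂ {b} {d} {n} {↥ x} {↧ x} 4∣b-1 4∣d-1 4∣n-1 (↥↧-coprime x 2∤1) dup

-- The points P, Q and R

module _ where

  open import Data.Integer.Base using (_+_; _*_; _-_; -_; _^_)

  independent-points : ∀ m → ¬ (+ 2 ∣ₛ m) → + 3 ∣ₛ m → ∃ λ P → ∃₂ λ Q R →
    ¬ SomeSum (_⊕_ (E m)) (Double (rationalPoints (E m))) P Q R
  independent-points m 2∤m 3∣m = P , Q , R , independent
    where
    open ℤSolver
    infixl 6 _⊞ₚ_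
    _⊞ₚ_ = _⊕_ (E m)
    b = m ^ 6
    m² = m * m
    m³ = m * m * m

    4∣m²-1 = odd⇒4∣m²-1 m 2∤m
    4∣b-1 = odd⇒4∣m⁶-1 m 2∤m

    3∣b : + 3 ∣ₛ b
    3∣b = ∣m⇒∣m*n _ 3∣m

    P-on = onCurve m (- m²) m
      (solve 1 (λ m → let u = :- (m :* m) in
         m :* m := u :* u :* u :+ con (- + 1) :* u :+ m :^ 6)
         refl m)
    Q-on = onCurve m (+ 0) m³
      (solve 1 (λ m → let v = m :* m :* m ; u = con (+ 0) in
         v :* v := u :* u :* u :+ con (- + 1) :* u :+ m :^ 6)
         refl m)
    R-on = onCurve m (+ 1) m³
      (solve 1 (λ m → let v = m :* m :* m ; u = con (+ 1) in
         v :* v := u :* u :* u :+ con (- + 1) :* u :+ m :^ 6)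
         refl m)
    S-on = onCurve m (- + 1) (- m³)
      (solve 1 (λ m → let v = :- (m :* m :* m) ; u = con (- + 1) in
         v :* v := u :* u :* u :+ con (- + 1) :* u :+ m :^ 6)
         refl m)

    P Q R S : Point (E m)
    P = aff (fromℤ (- m²)) (fromℤ m) P-on
    Q = aff (fromℤ (+ 0)) (fromℤ m³) Q-on
    R = aff (fromℤ (+ 1)) (fromℤ m³) R-on
    S = aff (fromℤ (- + 1)) (fromℤ (- m³)) S-on

    -- The line y = m³ meets the curve at 0, 1 and -1. Through `S`, the triple sum becomes a chord
    -- sum of two integral points.
    Q+R≡S : Q ⊞ₚ R ≡ S
    Q+R≡S = horizontal (E m)
      (addition (E m) {fromℤ (+ 0)} {fromℤ m³} {fromℤ (+ 1)} {fromℤ m³} Q-on R-on)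
      (λ ()) refl (sym (fromℤ-neg m³))

    integral : ∀ u v .(on : OnCurve (E m) (fromℤ u) (fromℤ v)) →
               ¬ Double (rationalPoints (E m)) (aff (fromℤ u) (fromℤ v) on)
    integral u v on = ¬double₃ m {+ 1} {u} 3∣b (divides (+ 0) refl) (ℚ.*-identityʳ (fromℤ u))

    secant₃ : ∀ u₁ v₁ u₂ v₂ .(on₁ : OnCurve (E m) (fromℤ u₁) (fromℤ v₁))
      .(on₂ : OnCurve (E m) (fromℤ u₂) (fromℤ v₂)) → + 3 ∣ₛ (u₂ - u₁) * (u₂ - u₁) - + 1 →
      ¬ Double (rationalPoints (E m)) (aff (fromℤ u₁) (fromℤ v₁) on₁ ⊞ₚ aff (fromℤ u₂) (fromℤ v₂) on₂)
    secant₃ u₁ v₁ u₂ v₂ on₁ on₂ 3∣d-1 = ¬double₃ m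
      {(u₂ - u₁) * (u₂ - u₁)} {(v₂ - v₁) * (v₂ - v₁) - (u₁ + u₂) * ((u₂ - u₁) * (u₂ - u₁))} 3∣b 3∣d-1
      (integral-secant m u₁ v₁ u₂ v₂ on₁ on₂ 3∤1 3∣d-1)

    ¬double-Q+R = secant₃ (+ 0) m³ (+ 1) m³ Q-on R-on (divides (+ 0) refl)

    -- As 3 ∣ m, the abscissa -m² is 0 modulo 3, so its difference from 1, and below from -1, has
    -- square 1 modulo 3.
    ¬double-P+R = secant₃ (- m²) m (+ 1) m³ P-on R-on (subst (+ 3 ∣ₛ_)
      (solve 1 (λ m → let d = con (+ 1) :- :- (m :* m) in
         m :* (m :* (m :* m :+ con (+ 2))) := d :* d :- con (+ 1)) refl m)
      (∣m⇒∣m*n (m * (m² + + 2)) 3∣m))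

    ¬double-P+S = secant₃ (- m²) m (- + 1) (- m³) P-on S-on (subst (+ 3 ∣ₛ_)
      (solve 1 (λ m → let d = con (- + 1) :- :- (m :* m) in
         m :* (m :* (m :* m :- con (+ 2))) := d :* d :- con (+ 1)) refl m)
      (∣m⇒∣m*n (m * (m² - + 2)) 3∣m))

    -- Now d = m² is divisible by 3, so the modulus is 4 instead: d² = m⁴ is 1, the difference of
    -- ordinates m³ - m is 0, and the numerator (m³ - m)² + m⁶ is 1.
    ¬double-P+Q : ¬ Double (rationalPoints (E m)) (P ⊞ₚ Q)
    ¬double-P+Q = ¬double₂ m {d * d} {(m³ - m) * (m³ - m) - (- m² + + 0) * (d * d)} 4∣b-1 4∣d²-1
      (subst (+ 4 ∣ₛ_)
        (solve 1 (λ m →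
          let m² = m :* m
              e = m :* m :* m :- m
              d = con (+ 0) :- :- m² in
          (m² :- con (+ 1)) :* (m² :* (m² :- con (+ 1)) :+ m² :* m² :+ m² :+ con (+ 1))
          := e :* e :- (:- m² :+ con (+ 0)) :* (d :* d) :- con (+ 1)) refl m)
        (∣m⇒∣m*n (m² * (m² - + 1) + m² * m² + m² + + 1) 4∣m²-1))
      (integral-secant m (- m²) m (+ 0) m³ P-on Q-on (from-no (+ 4 ∣ₛ? + 1)) 4∣d²-1)
      where
      d = + 0 - - m²
      4∣d²-1 : + 4 ∣ₛ d * d - + 1
      4∣d²-1 = subst (+ 4 ∣ₛ_)
        (solve 1 (λ m → let d = con (+ 0) :- :- (m :* m) in
           (m :* m :- con (+ 1)) :* (m :* m :+ con (+ 1)) := d :* d :- con (+ 1)) refl m)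
        (∣m⇒∣m*n (m² + + 1) 4∣m²-1)

    independent : ¬ SomeSum _⊞ₚ_ (Double (rationalPoints (E m))) P Q R
    independent = Sum.[ integral (- m²) m P-on , Sum.[ integral (+ 0) m³ Q-on ,
      Sum.[ integral (+ 1) m³ R-on , Sum.[ ¬double-P+Q , Sum.[ ¬double-P+R ,
      Sum.[ ¬double-Q+R , ¬double-P+S ∘ subst (λ S → Double (rationalPoints (E m)) (P ⊞ₚ S)) Q+R≡S
      ]′ ]′ ]′ ]′ ]′ ]′

theorem1p1 : (m : ℤ) → + 1 < m → ¬ (+ 2 ∣ m) → + 3 ∣ m →
    ∀ r → HasRank (E m) r → 3 ≤ r
theorem1p1 m _ 2∤m 3∣m r (T , T-finite , E≅ℤ^r⊞T) =
  rank≥3 T T-finite E≅ℤ^r⊞T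
    (noTwoTorsion m (∣-trans (divides (+ 2) refl) (odd⇒4∣m⁶-1 m (2∤m ∘ ∣⇒∣ᵤ))))
    (proj₂ (proj₂ (proj₂ (independent-points m (2∤m ∘ ∣⇒∣ᵤ) (∣ᵤ⇒∣ 3∣m)))))
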